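{- Let $G$ be a multigraph of order at least $2$. Then there is a multigraph $H$, obtained from $G$ by adding a new edge between a pair of distinct (possibly already adjacent) vertices of $G$, such that $\mu(H)>\mu(G)$.
   Context: Multigraphs are finite, loopless, and may contain multiple (parallel) edges, which are distinguished from one another; they need not be connected. The order of a multigraph is its number of vertices. A subtree of a multigraph $G$ is a (not necessarily induced) subgraph of $G$ that is a tree; subtrees using different parallel edges are different subtrees. The null graph (with no vertices) is not counted as a subtree, while single vertices are. Let $\mathcal{T}_G$ be the set of subtrees of $G$ and $S_G(x)=\sum_{T\in\mathcal{T}_G}x^{|V(T)|}$. The mean subtree order of $G$ is the average order of a subtree of $G$, that is, $\mu(G)=S_G'(1)/S_G(1)$. -}

module Defs where

open import Data.Bool using (true; false)
open import Data.Fin using (Fin; zero; suc)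
import Data.Fin.Properties as Fin
open import Data.Fin.Subset using (Subset; Nonempty; _∈_; ∣_∣; inside; outside)
open import Data.Fin.Subset.Properties using (_∈?_; nonempty?)
open import Data.Integer using (+_)
open import Data.List
  using (List; []; _∷_; _++_; map; filter; length; lookup; cartesianProduct)
open import Data.List.Membership.Propositional using () renaming (_∈_ to _∈ˡ_)
open import Data.List.Membership.Propositional.Properties
  using (∈-map⁺; ∈-map⁻; ∈-++⁺ˡ; ∈-++⁺ʳ; ∈-lookup; ∈-filter⁺; ∈-filter⁻; ∈-cartesianProduct⁺)
import Data.List.Relation.Unary.All as All
open import Data.List.Relation.Unary.All.Properties using (¬Any⇒All¬)
open import Data.List.Relation.Unary.Any using (here; there; any?)
open import Data.List.Relation.Unary.Unique.Propositional using (Unique; []; _∷_)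
import Data.List.Relation.Unary.Unique.Propositional.Properties as Unique
open import Data.List.Relation.Unary.Unique.DecPropositional using (unique?)
open import Data.Nat.ListAction using (sum)
open import Data.Nat using (ℕ; zero; suc; _≤_; _<_; s≤s)
import Data.Nat.Properties as ℕ
open import Data.Product using (Σ-syntax; ∃; _×_; _,_; proj₁; proj₂)
open import Data.Product.Properties using (≡-dec)
open import Data.Rational using (ℚ; 0ℚ; _/_)
open import Data.Sum using (_⊎_; inj₁; inj₂)
open import Data.Unit using (⊤; tt)
open import Data.Vec using ([]; _∷_)
import Data.Vec.Properties as Vec
open import Function using (_∘_; _⇔_; mk⇔)
open import Relation.Binary.PropositionalEquality
  using (_≡_; _≢_; refl; sym; cong; subst)
open import Relation.Nullary
  using (¬_; Dec; yes; no; ¬?; _×-dec_; _⊎-dec_; _→-dec_; contradiction)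
open import Relation.Nullary.Decidable using (map′)

-- Edges are labelled, so parallel edges are distinct.  The endpoints of an
-- edge are listed in an order that carries no meaning: see Joins.
record Multigraph : Set where
  field
    order    : ℕ
    size     : ℕ
    ends     : Fin size → Fin order × Fin order
    loopless : ∀ e → proj₁ (ends e) ≢ proj₂ (ends e)

  Vertex : Set
  Vertex = Fin order

  Edge : Set
  Edge = Fin size

open Multigraph public using (order; Vertex)

addEdge : (G : Multigraph) (u v : Vertex G) → u ≢ v → Multigraph
addEdge G u v u≢v = record
  { order    = G.order
  ; size     = suc G.size
  ; ends     = λ { zero → u , v ; (suc e) → G.ends e }
  ; loopless = λ { zero → u≢v ; (suc e) → G.loopless e }
  }
  where module G = Multigraph G

allSubsets : ∀ n → List (Subset n)
allSubsets zero    = [] ∷ []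
allSubsets (suc n) = map (outside ∷_) (allSubsets n) ++ map (inside ∷_) (allSubsets n)

∈-allSubsets : ∀ {n} (p : Subset n) → p ∈ˡ allSubsets n
∈-allSubsets []                  = here refl
∈-allSubsets {suc n} (false ∷ p) = ∈-++⁺ˡ (∈-map⁺ (outside ∷_) (∈-allSubsets p))
∈-allSubsets {suc n} (true ∷ p)  =
  ∈-++⁺ʳ (map (outside ∷_) (allSubsets n)) (∈-map⁺ (inside ∷_) (∈-allSubsets p))

allSubsets-unique : ∀ n → Unique (allSubsets n)
allSubsets-unique zero    = All.[] ∷ []
allSubsets-unique (suc n) = Unique.++⁺
  (Unique.map⁺ Vec.∷-injectiveʳ (allSubsets-unique n))
  (Unique.map⁺ Vec.∷-injectiveʳ (allSubsets-unique n))
  disjoint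
  where
  disjoint : ∀ {p} → ¬ (p ∈ˡ map (outside ∷_) (allSubsets n) × p ∈ˡ map (inside ∷_) (allSubsets n))
  disjoint (p∈ , p∈′) with ∈-map⁻ (outside ∷_) p∈ | ∈-map⁻ (inside ∷_) p∈′
  ... | _ , _ , refl | _ , _ , ()

unique⇒length≤ : ∀ {n} {xs : List (Fin n)} → Unique xs → length xs ≤ n
unique⇒length≤ {n} xs! = Fin.injective⇒≤ (lookup-inj xs! _ _)
  where
  lookup-inj : ∀ {xs : List (Fin n)} → Unique xs → ∀ i j → lookup xs i ≡ lookup xs j → i ≡ j
  lookup-inj (x∉ ∷ xs!) zero    zero    eq = refl
  lookup-inj (x∉ ∷ xs!) zero    (suc j) eq = contradiction eq (All.lookup x∉ (∈-lookup j))
  lookup-inj (x∉ ∷ xs!) (suc i) zero    eq = contradiction (sym eq) (All.lookup x∉ (∈-lookup i))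
  lookup-inj (x∉ ∷ xs!) (suc i) (suc j) eq = cong suc (lookup-inj xs! i j eq)

module _ (G : Multigraph) where
  open Multigraph G using (size; ends; Edge)

  private
    V : Set
    V = Vertex G

  Joins : Edge → V → V → Set
  Joins e u v = ends e ≡ (u , v) ⊎ ends e ≡ (v , u)

  joins? : ∀ e u v → Dec (Joins e u v)
  joins? e u v = ends e ≟ (u , v) ⊎-dec ends e ≟ (v , u)
    where _≟_ = ≡-dec Fin._≟_ Fin._≟_

  data Walk (F : Subset size) : V → V → Set where
    nil  : ∀ {u} → Walk F u u
    step : ∀ {u v w} (e : Edge) → e ∈ F → Joins e u v → Walk F v w → Walk F u w

  edges : ∀ {F u v} → Walk F u v → List Edge
  edges nil            = []
  edges (step e _ _ p) = e ∷ edges p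

  -- The vertices visited, except the last one.
  sources : ∀ {F u v} → Walk F u v → List V
  sources nil                = []
  sources (step {u} _ _ _ p) = u ∷ sources p

  -- Two parallel edges form a cycle; traversing one edge back and forth does not.
  IsCycle : ∀ {F u} → Walk F u u → Set
  IsCycle p = edges p ≢ [] × Unique (edges p) × Unique (sources p)

  Acyclic : Subset size → Set
  Acyclic F = ¬ (∃ λ u → Σ[ p ∈ Walk F u u ] IsCycle p)

  -- T is a vertex set together with an edge set.
  record IsSubtree (T : Subset (order G) × Subset size) : Set where
    private
      W = proj₁ T
      F = proj₂ T
    field
      subgraph  : ∀ e → e ∈ F → proj₁ (ends e) ∈ W × proj₂ (ends e) ∈ W
      nonempty  : Nonempty W
      connected : ∀ u → u ∈ W → ∀ v → v ∈ W → Walk F u v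
      acyclic   : Acyclic F

  module _ (F : Subset size) where

    -- P sees only the edges and sources of a walk, so that it does not depend on
    -- the membership and incidence proofs a walk carries.
    walkOfLength? : ∀ k u v {P : List Edge → List V → Set} → (∀ es us → Dec (P es us)) →
                    Dec (Σ[ p ∈ Walk F u v ] (length (edges p) ≡ k × P (edges p) (sources p)))
    walkOfLength? zero u v {P} P? = map′
      (λ { (refl , P[]) → nil , refl , P[] })
      (λ { (nil , _ , P[]) → refl , P[] ; (step _ _ _ _ , () , _) })
      (u Fin.≟ v ×-dec P? [] [])
    walkOfLength? (suc k) u v {P} P? = map′
      (λ { (e , w , e∈F , j , p , eq , Pp) → step e e∈F j p , cong suc eq , Pp })
      (λ { (step e e∈F j p , eq , Pp) → e , _ , e∈F , j , p , ℕ.suc-injective eq , Pp })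
      (Fin.any? λ e → Fin.any? λ w → e ∈? F ×-dec joins? e u w ×-dec
        walkOfLength? k w v (λ es us → P? (e ∷ es) (u ∷ us)))

    walkShorterThan? : ∀ b u v {P : List Edge → List V → Set} → (∀ es us → Dec (P es us)) →
                       Dec (Σ[ p ∈ Walk F u v ] (length (edges p) < b × P (edges p) (sources p)))
    walkShorterThan? b u v P? = map′
      (λ { (_ , k<b , p , refl , Pp) → p , k<b , Pp })
      (λ { (p , p<b , Pp) → _ , p<b , p , refl , Pp })
      (ℕ.anyUpTo? (λ k → walkOfLength? k u v P?) b)

    length-sources : ∀ {u v} (p : Walk F u v) → length (edges p) ≡ length (sources p)
    length-sources nil            = refl
    length-sources (step _ _ _ p) = cong suc (length-sources p)

    dropUntil : ∀ {u v w} (p : Walk F u v) → Unique (sources p) → w ∈ˡ sources p →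
                Σ[ q ∈ Walk F w v ] Unique (sources q)
    dropUntil p@(step _ _ _ _) p!       (here refl) = p , p!
    dropUntil (step _ _ _ p)   (_ ∷ p!) (there w∈)  = dropUntil p p! w∈

    shorten : ∀ {u v} → Walk F u v → Σ[ p ∈ Walk F u v ] Unique (sources p)
    shorten nil = nil , []
    shorten (step {u} e e∈F j p) with shorten p
    ... | q , q! with any? (u Fin.≟_) (sources q)
    ...   | yes u∈ = dropUntil q q! u∈
    ...   | no  u∉ = step e e∈F j q , ¬Any⇒All¬ _ u∉ ∷ q!

    walk? : ∀ u v → Dec (Walk F u v)
    walk? u v = map′ proj₁ back
      (walkShorterThan? (suc (order G)) u v {λ _ _ → ⊤} (λ _ _ → yes tt))
      where
      back : Walk F u v → Σ[ p ∈ Walk F u v ] (length (edges p) < suc (order G) × ⊤)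
      back p with shorten p
      ... | q , q! = q , s≤s (subst (_≤ order G) (sym (length-sources q)) (unique⇒length≤ q!)) , tt

    acyclic? : Dec (Acyclic F)
    acyclic? = ¬? (Fin.any? λ u → map′
      (λ { (p , _ , c) → p , c })
      (λ { (p , c) → p , s≤s (unique⇒length≤ (proj₁ (proj₂ c))) , c })
      (walkShorterThan? (suc size) u u
        {λ es us → es ≢ [] × Unique es × Unique us}
        (λ es us → nonNil? es ×-dec unique? Fin._≟_ es ×-dec unique? Fin._≟_ us)))
      where
      nonNil? : ∀ (es : List Edge) → Dec (es ≢ [])
      nonNil? []      = no λ ne → ne refl
      nonNil? (_ ∷ _) = yes λ ()

  isSubtree? : ∀ T → Dec (IsSubtree T)
  isSubtree? (W , F) = map′
    (λ { (s , n , c , a) → record { subgraph = s ; nonempty = n ; connected = c ; acyclic = a } })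
    (λ t → let open IsSubtree t in subgraph , nonempty , connected , acyclic)
    ( (Fin.all? λ e → e ∈? F →-dec (proj₁ (ends e) ∈? W ×-dec proj₂ (ends e) ∈? W))
    ×-dec nonempty? W
    ×-dec (Fin.all? λ u → u ∈? W →-dec Fin.all? λ v → v ∈? W →-dec walk? F u v)
    ×-dec acyclic? F)

  subtrees : List (Subset (order G) × Subset size)
  subtrees = filter isSubtree? (cartesianProduct (allSubsets (order G)) (allSubsets size))

  ∈-subtrees : ∀ {T} → T ∈ˡ subtrees ⇔ IsSubtree T
  ∈-subtrees {W , F} = mk⇔
    (λ T∈ → proj₂ (∈-filter⁻ isSubtree? {xs = candidates} T∈))
    (∈-filter⁺ isSubtree? (∈-cartesianProduct⁺ (∈-allSubsets W) (∈-allSubsets F)))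
    where candidates = cartesianProduct (allSubsets (order G)) (allSubsets size)

  subtrees-unique : Unique subtrees
  subtrees-unique = Unique.filter⁺ isSubtree?
    (Unique.cartesianProduct⁺ (allSubsets-unique (order G)) (allSubsets-unique size))

-- The value on [] is a convention; it is reached only for the multigraph of order 0.
mean : List ℕ → ℚ
mean []          = 0ℚ
mean xs@(_ ∷ _) = + sum xs / length xs

μ : Multigraph → ℚ
μ G = mean (map (λ T → ∣ proj₁ T ∣) (subtrees G))

-- Doubling an edge e of G creates one new subtree, of the same order, for every
-- subtree of G through e, so it suffices to find an edge e for which the subtrees
-- through e have mean order above μ(G).  Summed over all e, these families count
-- every subtree T exactly ∣ T ∣ − 1 times; weighting by an increasing function of the
-- order raises the mean, strictly so because both single vertices and single edges
-- are subtrees.  Hence some e works.  Without edges μ(G) = 1, and any edge will do.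

{-# OPTIONS --safe #-}
module Submission where

open import Data.Bool using (true; false; if_then_else_)
open import Data.Fin using (Fin; zero; suc)
import Data.Fin.Properties as Fin
open import Data.Fin.Subset using (Subset; _∈_; _∉_; ∣_∣; inside; outside; _-_; _∪_; ⁅_⁆; ⊥)
open import Data.Fin.Subset.Properties
  using (_∈?_; x∈p∧x≢y⇒x∈p-y; x∈p⇒∣p-x∣<∣p∣; p─q⊆p; p─⊥≡p; x∈⁅x⁆; x∈⁅y⁆⇒x≡y;
         x∈p∪q⁺; x∈p∪q⁻; ∉⊥; ∣⊥∣≡0; ∣⁅x⁆∣≡1; Empty-unique)
import Data.Integer as ℤ
import Data.Integer.Properties as ℤ
open import Data.List using (List; []; _∷_; _++_; map; filter; length; tabulate)
open import Data.List.Membership.Propositional using () renaming (_∈_ to _∈ˡ_)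
open import Data.List.Membership.Propositional.Properties
  using (∈-map⁺; ∈-map⁻; ∈-++⁺ˡ; ∈-++⁺ʳ; ∈-++⁻; ∈-∃++; ∈-map∘filter⁺; ∈-map∘filter⁻)
open import Data.List.Membership.Propositional.Properties.WithK using (unique∧set⇒bag)
open import Data.List.Properties using (map-id; map-++; map-∘; map-cong-local; length-map; length-++)
open import Data.List.Relation.Binary.BagAndSetEquality using (∼bag⇒↭)
open import Data.List.Relation.Binary.Permutation.Propositional using (_↭_)
open import Data.List.Relation.Binary.Permutation.Propositional.Properties using (shift; map⁺; ↭-length)
open import Data.List.Relation.Unary.All as All using (All; []; _∷_)
open import Data.List.Relation.Unary.All.Properties using (¬Any⇒All¬; All¬⇒¬Any)
import Data.List.Relation.Unary.All.Properties as All
open import Data.List.Relation.Unary.Any using (here; there; any?)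
open import Data.List.Relation.Unary.Unique.Propositional using (Unique; []; _∷_)
import Data.List.Relation.Unary.Unique.Propositional.Properties as Unique
open import Data.Nat using (ℕ; NonZero; zero; suc; _+_; _*_; _≤_; _<_; z≤n; s≤s)
open import Data.Nat.ListAction using (sum)
open import Data.Nat.ListAction.Properties using (sum-++; sum-↭)
import Data.Nat.Properties as ℕ
open import Data.Nat.Tactic.RingSolver using (solve-∀)
open import Data.Product using (Σ-syntax; ∃; ∃₂; _×_; _,_; proj₁; proj₂)
open import Data.Rational using (_>_) renaming (_<_ to _<ℚ_)
import Data.Rational.Properties as ℚ
open import Data.Rational.Unnormalised using (mkℚᵘ; *<*)
import Data.Rational.Unnormalised.Properties as ℚᵘ
open import Data.Sum using (_⊎_; inj₁; inj₂; swap)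
open import Data.Vec using ([]; _∷_; here; there; lookup; _[_]≔_)
import Data.Vec.Properties as Vec
open import Function using (_∘_; id; const; mk⇔; Equivalence)
open import Relation.Binary.PropositionalEquality
  using (_≡_; _≢_; refl; sym; trans; cong; cong₂; subst; subst₂)
open import Relation.Nullary using (¬_; Dec; does; yes; no; contradiction)
open import Defs

open Multigraph using (size; ends; loopless; Edge)

-- Finite subsets

x∉p-x : ∀ {n} (p : Subset n) x → x ∉ p - x
x∉p-x (_ ∷ p) zero    ()
x∉p-x (_ ∷ p) (suc x) (there x∈) = x∉p-x p x x∈

x∈p⇒∣p∣≡1+∣p-x∣ : ∀ {n} {p : Subset n} {x} → x ∈ p → ∣ p ∣ ≡ suc ∣ p - x ∣
x∈p⇒∣p∣≡1+∣p-x∣ {p = _ ∷ p}       here       = cong (suc ∘ ∣_∣) (sym (p─⊥≡p p))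
x∈p⇒∣p∣≡1+∣p-x∣ {p = inside ∷ p}  (there x∈) = cong suc (x∈p⇒∣p∣≡1+∣p-x∣ x∈)
x∈p⇒∣p∣≡1+∣p-x∣ {p = outside ∷ p} (there x∈) = x∈p⇒∣p∣≡1+∣p-x∣ x∈

-- The map takes a membership proof because parent edges and child ends are defined only on members.
-- The induction removes the image of the first member from `q`.
injection⇒∣p∣≤∣q∣ : ∀ {m n} (p : Subset m) (q : Subset n) (f : ∀ x → x ∈ p → Fin n) →
                    (∀ x x∈ → f x x∈ ∈ q) →
                    (∀ x y x∈ y∈ → f x x∈ ≡ f y y∈ → x ≡ y) →
                    ∣ p ∣ ≤ ∣ q ∣
injection⇒∣p∣≤∣q∣ []            q f f∈ f-inj = z≤n
injection⇒∣p∣≤∣q∣ (outside ∷ p) q f f∈ f-inj =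
  injection⇒∣p∣≤∣q∣ p q (λ x x∈ → f (suc x) (there x∈)) (λ x x∈ → f∈ (suc x) (there x∈))
    (λ x y x∈ y∈ eq → Fin.suc-injective (f-inj _ _ _ _ eq))
injection⇒∣p∣≤∣q∣ (inside ∷ p)  q f f∈ f-inj = ℕ.≤-<-trans
  (injection⇒∣p∣≤∣q∣ p (q - f zero here) (λ x x∈ → f (suc x) (there x∈))
    (λ x x∈ → x∈p∧x≢y⇒x∈p-y (f∈ (suc x) (there x∈)) λ eq → contradiction (f-inj _ _ _ _ eq) λ ())
    (λ x y x∈ y∈ eq → Fin.suc-injective (f-inj _ _ _ _ eq)))
  (x∈p⇒∣p-x∣<∣p∣ (f∈ zero here))

-- Maps between edge sets on a common vertex set

-- Splitting off the vertex set lets two multigraphs share it definitionally, so walks in both have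
-- ends of the same type.
record Edges (n : ℕ) : Set where
  field
    size     : ℕ
    ends     : Fin size → Fin n × Fin n
    loopless : ∀ e → proj₁ (ends e) ≢ proj₂ (ends e)

graph : ∀ {n} → Edges n → Multigraph
graph {n} A = record { order = n ; Edges A }

edgesOf : (G : Multigraph) → Edges (order G)
edgesOf G = record { Multigraph G }

-- Vertices stay fixed. The conditions concern members of `F` only, since merging an edge with its
-- copy is injective only on suitable edge sets.
record Embedding {n} (A B : Edges n) (F : Subset (Edges.size A)) (F′ : Subset (Edges.size B)) : Set where
  field
    to      : Fin (Edges.size A) → Fin (Edges.size B)
    to∈     : ∀ {e} → e ∈ F → to e ∈ F′
    ends-to : ∀ {e} → e ∈ F → Edges.ends B (to e) ≡ Edges.ends A e
    to-inj  : ∀ {e f} → e ∈ F → f ∈ F → to e ≡ to f → e ≡ f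

edges⊆ : ∀ (G : Multigraph) {F u v} (p : Walk G F u v) → All (_∈ F) (edges G p)
edges⊆ G nil             = []
edges⊆ G (step _ e∈ _ p) = e∈ ∷ edges⊆ G p

unique-map : ∀ {A B : Set} {P : A → Set} (f : A → B) →
             (∀ {x y} → P x → P y → f x ≡ f y → x ≡ y) →
             ∀ {xs} → All P xs → Unique xs → Unique (map f xs)
unique-map f f-inj []         []         = []
unique-map f f-inj (px ∷ pxs) (x∉ ∷ xs!) =
  All.map⁺ (All.zipWith (λ (py , x≢y) → x≢y ∘ f-inj px py) (pxs , x∉)) ∷ unique-map f f-inj pxs xs!

module _ {n} {A B : Edges n} {F F′} (φ : Embedding A B F F′) where
  open Embedding φ
  private
    G  = graph A
    G′ = graph B

  mapWalk : ∀ {u v} → Walk G F u v → Walk G′ F′ u v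
  mapWalk nil                     = nil
  mapWalk (step {u} {v} e e∈ j p) =
    step (to e) (to∈ e∈) (subst (λ x → x ≡ (u , v) ⊎ x ≡ (v , u)) (sym (ends-to e∈)) j) (mapWalk p)

  edges-mapWalk : ∀ {u v} (p : Walk G F u v) → edges G′ (mapWalk p) ≡ map to (edges G p)
  edges-mapWalk nil            = refl
  edges-mapWalk (step e _ _ p) = cong (to e ∷_) (edges-mapWalk p)

  sources-mapWalk : ∀ {u v} (p : Walk G F u v) → sources G′ (mapWalk p) ≡ sources G p
  sources-mapWalk nil                = refl
  sources-mapWalk (step {u} _ _ _ p) = cong (u ∷_) (sources-mapWalk p)

  unique-edges-mapWalk : ∀ {u v} (p : Walk G F u v) → Unique (edges G p) → Unique (edges G′ (mapWalk p))
  unique-edges-mapWalk p p! = subst Unique (sym (edges-mapWalk p)) (unique-map to to-inj (edges⊆ G p) p!)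

  -- A cycle is carried to a cycle: injectivity keeps its edges distinct, and the vertices visited
  -- do not change.
  acyclic-reflect : Acyclic G′ F′ → Acyclic G F
  acyclic-reflect acyclic (u , p , ne , es! , us!) =
    acyclic (u , mapWalk p , nonNil p ne , unique-edges-mapWalk p es! ,
             subst Unique (sym (sources-mapWalk p)) us!)
    where
    nonNil : ∀ {u v} (p : Walk G F u v) → edges G p ≢ [] → edges G′ (mapWalk p) ≢ []
    nonNil nil            ne _ = ne refl
    nonNil (step _ _ _ _) ne ()

-- Connecting walks are pushed along `φ`, while incidence and acyclicity are pulled back along `ψ`.
isSubtree-transfer : ∀ {n} {A B : Edges n} {W F F′} → Embedding A B F F′ → Embedding B A F′ F →
                     IsSubtree (graph A) (W , F) → IsSubtree (graph B) (W , F′)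
isSubtree-transfer {A = A} {B} {W} φ ψ t = record
  { subgraph  = λ e e∈ → subst (λ x → proj₁ x ∈ W × proj₂ x ∈ W) (Embedding.ends-to ψ e∈)
                           (T.subgraph _ (Embedding.to∈ ψ e∈))
  ; nonempty  = T.nonempty
  ; connected = λ u u∈ v v∈ → mapWalk φ (T.connected u u∈ v v∈)
  ; acyclic   = acyclic-reflect ψ T.acyclic
  }
  where module T = IsSubtree t

-- Walks, paths and bridges

module _ (G : Multigraph) where

  private
    V = Vertex G
    E = Edge G

  delete-embedding : ∀ {F} (f : E) → Embedding (edgesOf G) (edgesOf G) (F - f) F
  delete-embedding {F} f = record
    { to = id ; to∈ = p─q⊆p F ⁅ f ⁆ ; ends-to = λ _ → refl ; to-inj = λ _ _ → id }

  weaken : ∀ {F u v} f → Walk G (F - f) u v → Walk G F u v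
  weaken f = mapWalk (delete-embedding f)

  _++ʷ_ : ∀ {F u v w} → Walk G F u v → Walk G F v w → Walk G F u w
  nil           ++ʷ q = q
  step e e∈ j p ++ʷ q = step e e∈ j (p ++ʷ q)

  reverse : ∀ {F u v} → Walk G F u v → Walk G F v u
  reverse nil             = nil
  reverse (step e e∈ j p) = reverse p ++ʷ step e e∈ (swap j) nil

  -- Unlike `sources`, this includes the end, so that distinctness characterises paths and rules out
  -- nonempty closed walks.
  vertices : ∀ {F u v} → Walk G F u v → List V
  vertices {u = u} nil        = u ∷ []
  vertices (step {u} _ _ _ p) = u ∷ vertices p

  head∈ : ∀ {F u v} (p : Walk G F u v) → u ∈ˡ vertices p
  head∈ nil            = here refl
  head∈ (step _ _ _ _) = here refl

  last∈ : ∀ {F u v} (p : Walk G F u v) → v ∈ˡ vertices p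
  last∈ nil            = here refl
  last∈ (step _ _ _ p) = there (last∈ p)

  sources⊆ : ∀ {F u v} {P : V → Set} (p : Walk G F u v) → All P (vertices p) → All P (sources G p)
  sources⊆ nil            _        = []
  sources⊆ (step _ _ _ p) (x ∷ xs) = x ∷ sources⊆ p xs

  -- The end is put in front because prepending an edge from the end to the start closes the path to
  -- a cycle with exactly these sources.
  unique-sources : ∀ {F u v} (p : Walk G F u v) → Unique (vertices p) → Unique (v ∷ sources G p)
  unique-sources nil            _        = [] ∷ []
  unique-sources (step _ _ _ p) (u∉ ∷ p!) with unique-sources p p!
  ... | v∉ ∷ s! = ((All.lookup u∉ (last∈ p) ∘ sym) ∷ v∉) ∷ sources⊆ p u∉ ∷ s!

  ends∈ : ∀ {F u v e a b} (p : Walk G F u v) → e ∈ˡ edges G p → Joins G e a b → a ∈ˡ vertices p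
  ends∈ (step e _ (inj₁ eq) p) (here refl) (inj₁ eq′) with refl ← trans (sym eq) eq′ = here refl
  ends∈ (step e _ (inj₁ eq) p) (here refl) (inj₂ eq′) with refl ← trans (sym eq) eq′ = there (head∈ p)
  ends∈ (step e _ (inj₂ eq) p) (here refl) (inj₁ eq′) with refl ← trans (sym eq) eq′ = there (head∈ p)
  ends∈ (step e _ (inj₂ eq) p) (here refl) (inj₂ eq′) with refl ← trans (sym eq) eq′ = here refl
  ends∈ (step _ _ _ p)         (there e∈)  j = there (ends∈ p e∈ j)

  e∉edges : ∀ {F u v e a b} (p : Walk G F u v) → Joins G e a b →
            All (a ≢_) (vertices p) → All (e ≢_) (edges G p)
  e∉edges p j a∉ = ¬Any⇒All¬ _ λ e∈ → All¬⇒¬Any a∉ (ends∈ p e∈ j)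

  -- Were an edge traversed again, its starting vertex would reappear later on the path.
  unique-edges : ∀ {F u v} (p : Walk G F u v) → Unique (vertices p) → Unique (edges G p)
  unique-edges nil            _         = []
  unique-edges (step _ _ j p) (u∉ ∷ p!) = e∉edges p j u∉ ∷ unique-edges p p!

  suffix : ∀ {F u v w} (p : Walk G F u v) → Unique (vertices p) → w ∈ˡ vertices p →
           Σ[ q ∈ Walk G F w v ] Unique (vertices q)
  suffix nil              p!       (here refl) = nil , p!
  suffix p@(step _ _ _ _) p!       (here refl) = p , p!
  suffix (step _ _ _ p)   (_ ∷ p!) (there w∈)  = suffix p p! w∈

  -- Loop erasure: when the new starting vertex already lies on the path, the path is cut back to
  -- begin there.
  toPath : ∀ {F u v} → Walk G F u v → Σ[ p ∈ Walk G F u v ] Unique (vertices p)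
  toPath nil = nil , [] ∷ []
  toPath (step {u} e e∈ j p) with toPath p
  ... | q , q! with any? (u Fin.≟_) (vertices q)
  ...   | yes u∈ = suffix q q! u∈
  ...   | no  u∉ = step e e∈ j q , ¬Any⇒All¬ _ u∉ ∷ q!

  restrict : ∀ {F u v f} (p : Walk G F u v) → All (f ≢_) (edges G p) → Walk G (F - f) u v
  restrict nil             _        = nil
  restrict (step e e∈ j p) (f≢ ∷ f∉) = step e (x∈p∧x≢y⇒x∈p-y e∈ (f≢ ∘ sym)) j (restrict p f∉)

  -- A path between the ends of `f` that avoids `f` would be closed by `f` to a cycle.
  bridge : ∀ {F f u v} → Acyclic G F → f ∈ F → Joins G f v u → ¬ Walk G (F - f) u v
  bridge {F} {f} acyclic f∈ j p with toPath p
  ... | q , q! = acyclic (_ , step f f∈ j q′ , (λ ()) ,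
      subst Unique (sym (cong (f ∷_) edges-q′)) (f∉ ∷ unique-edges q q!) ,
      subst (Unique ∘ (_ ∷_)) (sym (sources-mapWalk (delete-embedding f) q)) (unique-sources q q!))
    where
    q′ = weaken f q
    edges-q′ : edges G q′ ≡ edges G q
    edges-q′ = trans (edges-mapWalk (delete-embedding f) q) (map-id _)
    f∉ : All (f ≢_) (edges G q)
    f∉ = All.map (λ { e∈ refl → x∉p-x F f e∈ }) (edges⊆ G q)

  -- The walk is cut at its last traversal of `f`; what follows avoids `f`.
  split : ∀ {F x r} f → Walk G F x r →
          Walk G (F - f) x r ⊎ ∃₂ λ c d → Joins G f c d × Walk G (F - f) d r
  split f nil = inj₁ nil
  split f (step e e∈ j p) with split f p
  ... | inj₂ q = inj₂ q
  ... | inj₁ q with e Fin.≟ f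
  ...   | yes refl = inj₂ (_ , _ , j , q)
  ...   | no e≢f   = inj₁ (step e (x∈p∧x≢y⇒x∈p-y e∈ e≢f) j q)

  joins-unique : ∀ {e a b c d} → Joins G e a b → Joins G e c d → (a ≡ c × b ≡ d) ⊎ (a ≡ d × b ≡ c)
  joins-unique (inj₁ eq) (inj₁ eq′) with refl ← trans (sym eq) eq′ = inj₁ (refl , refl)
  joins-unique (inj₁ eq) (inj₂ eq′) with refl ← trans (sym eq) eq′ = inj₂ (refl , refl)
  joins-unique (inj₂ eq) (inj₁ eq′) with refl ← trans (sym eq) eq′ = inj₂ (refl , refl)
  joins-unique (inj₂ eq) (inj₂ eq′) with refl ← trans (sym eq) eq′ = inj₁ (refl , refl)

  joins-ends : ∀ e → Joins G e (proj₁ (ends G e)) (proj₂ (ends G e))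
  joins-ends e = inj₁ refl

  joins⇒≢ : ∀ {e u v} → Joins G e u v → u ≢ v
  joins⇒≢ {e} (inj₁ eq) refl = loopless G e (trans (cong proj₁ eq) (sym (cong proj₂ eq)))
  joins⇒≢ {e} (inj₂ eq) refl = loopless G e (trans (cong proj₁ eq) (sym (cong proj₂ eq)))

  -- A path never returns to its start, so after its first edge it cannot use that edge again.
  firstEdge : ∀ {F v r} → v ≢ r → Walk G F v r →
              ∃₂ λ e w → e ∈ F × Joins G e v w × Walk G (F - e) w r
  firstEdge v≢r p with toPath p
  ... | nil           , _        = contradiction refl v≢r
  ... | step e e∈ j q , (v∉ ∷ _) = e , _ , e∈ , j , restrict q (e∉edges q j v∉)

  -- Trees have one more vertex than edges

  module _ {W F} (t : IsSubtree G (W , F)) where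
    open IsSubtree t

    private
      r : V
      r = proj₁ nonempty

      r∈W : r ∈ W
      r∈W = proj₂ nonempty

    joins⇒∈ : ∀ {e u v} → e ∈ F → Joins G e u v → u ∈ W
    joins⇒∈ {e} e∈ (inj₁ eq) = subst (λ x → proj₁ x ∈ W) eq (proj₁ (subgraph e e∈))
    joins⇒∈ {e} e∈ (inj₂ eq) = subst (λ x → proj₂ x ∈ W) eq (proj₂ (subgraph e e∈))

    private
      parentEdge : ∀ v → v ∈ W - r → ∃₂ λ e w → e ∈ F × Joins G e v w × Walk G (F - e) w r
      parentEdge v v∈ = firstEdge (λ { refl → x∉p-x W r v∈ })
        (connected v (p─q⊆p W ⁅ r ⁆ v∈) r r∈W)

      -- If `e` served both of its ends, each would reach `r` without `e`, and joining the two walks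
      -- would contradict `bridge`.
      parentEdge-inj : ∀ {e v w v′ w′} → e ∈ F → Joins G e v w → Walk G (F - e) w r →
                       Joins G e v′ w′ → Walk G (F - e) w′ r → v ≡ v′
      parentEdge-inj e∈ j p j′ p′ with joins-unique j j′
      ... | inj₁ (eq , _)      = eq
      ... | inj₂ (refl , refl) = contradiction (p ++ʷ reverse p′) (bridge acyclic e∈ j)

      -- Here `d` is the end that reaches `r` without `f`. A walk to `r` reveals it: either the walk
      -- avoids `f` and `d` is its start, or `d` is where the last traversal of `f` arrives.
      childEnd : ∀ f → f ∈ F → ∃₂ λ c d → Joins G f c d × Walk G (F - f) d r
      childEnd f f∈ with split f (connected _ (joins⇒∈ f∈ (joins-ends f)) r r∈W)
      ... | inj₁ p = _ , _ , swap (joins-ends f) , p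
      ... | inj₂ c = c

      childEnd∈ : ∀ {f c d} → f ∈ F → Joins G f c d → Walk G (F - f) d r → c ∈ W - r
      childEnd∈ f∈ j p = x∈p∧x≢y⇒x∈p-y (joins⇒∈ f∈ j) λ { refl → bridge acyclic f∈ j p }

      -- If f and f′ differed, c could be linked to r around one of them.
      childEnd-inj : ∀ {f f′ c d d′} → f ∈ F → f′ ∈ F → Joins G f c d → Walk G (F - f) d r →
                     Joins G f′ c d′ → Walk G (F - f′) d′ r → f ≡ f′
      childEnd-inj {f} {f′} {c} f∈ f′∈ j p j′ p′ with f Fin.≟ f′
      ... | yes f≡f′ = f≡f′
      ... | no f≢f′ = contradiction (p ++ʷ reverse (avoid f′∈- (split f′ p))) (bridge acyclic f∈ j)
        where
        f′∈- : f′ ∈ F - f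
        f′∈- = x∈p∧x≢y⇒x∈p-y f′∈ (f≢f′ ∘ sym)
        f∈- : f ∈ F - f′
        f∈- = x∈p∧x≢y⇒x∈p-y f∈ f≢f′
        avoid : f′ ∈ F - f →
                Walk G (F - f - f′) _ r ⊎ (∃₂ λ a b → Joins G f′ a b × Walk G (F - f - f′) b r) →
                Walk G (F - f) c r
        avoid _ (inj₁ q) = contradiction
          (p′ ++ʷ reverse (step f f∈- j (mapWalk commute q))) (bridge acyclic f′∈ j′)
          where
          commute : Embedding (edgesOf G) (edgesOf G) (F - f - f′) (F - f′)
          commute = record
            { to = id
            ; to∈ = λ {e} e∈ → x∈p∧x≢y⇒x∈p-y (p─q⊆p F ⁅ f ⁆ (p─q⊆p (F - f) ⁅ f′ ⁆ e∈))
                        λ { refl → x∉p-x (F - f) f′ e∈ }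
            ; ends-to = λ _ → refl ; to-inj = λ _ _ → id }
        avoid f′∈ (inj₂ (a , b , ab , q)) with joins-unique j′ ab
        ... | inj₁ (refl , refl) = step f′ f′∈ j′ (weaken f′ q)
        ... | inj₂ (refl , refl) = weaken f′ q

    -- The tree is rooted at `r`. Sending a vertex other than `r` to the first edge of a path to
    -- `r`, and an edge to its end farther from `r`, gives injections both ways between `W - r` and
    -- `F`.
    ∣W∣≡1+∣F∣ : ∣ W ∣ ≡ suc ∣ F ∣
    ∣W∣≡1+∣F∣ = trans (x∈p⇒∣p∣≡1+∣p-x∣ r∈W) (cong suc (ℕ.≤-antisym
      (injection⇒∣p∣≤∣q∣ (W - r) F
        (λ v v∈ → proj₁ (parentEdge v v∈))
        (λ v v∈ → proj₁ (proj₂ (proj₂ (parentEdge v v∈))))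
        vertexInj)
      (injection⇒∣p∣≤∣q∣ F (W - r)
        (λ f f∈ → proj₁ (childEnd f f∈))
        (λ f f∈ → let _ , _ , j , p = childEnd f f∈ in childEnd∈ f∈ j p)
        edgeInj)))
      where
      vertexInj : ∀ v v′ v∈ v′∈ → proj₁ (parentEdge v v∈) ≡ proj₁ (parentEdge v′ v′∈) → v ≡ v′
      vertexInj v v′ v∈ v′∈ eq with parentEdge v v∈ | parentEdge v′ v′∈
      vertexInj v v′ v∈ v′∈ refl | _ , _ , e∈ , j , p | _ , _ , _ , j′ , p′ = parentEdge-inj e∈ j p j′ p′
      edgeInj : ∀ f f′ f∈ f′∈ → proj₁ (childEnd f f∈) ≡ proj₁ (childEnd f′ f′∈) → f ≡ f′
      edgeInj f f′ f∈ f′∈ eq with childEnd f f∈ | childEnd f′ f′∈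
      edgeInj f f′ f∈ f′∈ refl | _ , _ , j , p | _ , _ , j′ , p′ = childEnd-inj f∈ f′∈ j p j′ p′

  -- Single vertices and single edges as subtrees

  isSubtree-vertex : ∀ v → IsSubtree G (⁅ v ⁆ , ⊥)
  isSubtree-vertex v = record
    { subgraph  = λ _ e∈ → contradiction e∈ ∉⊥
    ; nonempty  = v , x∈⁅x⁆ v
    ; connected = λ a a∈ b b∈ → subst (Walk G ⊥ a) (trans (x∈⁅y⁆⇒x≡y v a∈) (sym (x∈⁅y⁆⇒x≡y v b∈))) nil
    ; acyclic   = λ { (_ , nil , ne , _) → ne refl ; (_ , step _ e∈ _ _ , _) → ∉⊥ e∈ }
    }

  isSubtree-edge : ∀ e → let u , v = ends G e in IsSubtree G (⁅ u ⁆ ∪ ⁅ v ⁆ , ⁅ e ⁆)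
  isSubtree-edge e = record
    { subgraph  = sub
    ; nonempty  = u , u∈
    ; connected = λ a a∈ b b∈ → toU a∈ ++ʷ reverse (toU b∈)
    ; acyclic   = acyclic
    }
    where
    u = proj₁ (ends G e)
    v = proj₂ (ends G e)
    u∈ : u ∈ ⁅ u ⁆ ∪ ⁅ v ⁆
    u∈ = x∈p∪q⁺ (inj₁ (x∈⁅x⁆ u))
    sub : ∀ f → f ∈ ⁅ e ⁆ → proj₁ (ends G f) ∈ ⁅ u ⁆ ∪ ⁅ v ⁆ × proj₂ (ends G f) ∈ ⁅ u ⁆ ∪ ⁅ v ⁆
    sub f f∈ with refl ← x∈⁅y⁆⇒x≡y e f∈ = u∈ , x∈p∪q⁺ (inj₂ (x∈⁅x⁆ v))
    toU : ∀ {a} → a ∈ ⁅ u ⁆ ∪ ⁅ v ⁆ → Walk G ⁅ e ⁆ a u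
    toU a∈ with x∈p∪q⁻ ⁅ u ⁆ ⁅ v ⁆ a∈
    ... | inj₁ a∈u with refl ← x∈⁅y⁆⇒x≡y u a∈u = nil
    ... | inj₂ a∈v with refl ← x∈⁅y⁆⇒x≡y v a∈v = step e (x∈⁅x⁆ e) (inj₂ refl) nil
    acyclic : Acyclic G ⁅ e ⁆
    acyclic (_ , nil , ne , _)            = ne refl
    -- A cycle of length one would be a loop, and a longer one would repeat the only edge.
    acyclic (_ , step _ _ j nil , _)      = joins⇒≢ j refl
    acyclic (_ , step _ f∈ _ (step _ g∈ _ _) , _ , ((f≢g ∷ _) ∷ _) , _) =
      f≢g (trans (x∈⁅y⁆⇒x≡y e f∈) (sym (x∈⁅y⁆⇒x≡y e g∈)))

-- Sums and means

+-interchange : ∀ a b c d → (a + b) + (c + d) ≡ (a + c) + (b + d)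
+-interchange = solve-∀

sum-tabulate-+ : ∀ {m} (a b : Fin m → ℕ) →
                 sum (tabulate λ e → a e + b e) ≡ sum (tabulate a) + sum (tabulate b)
sum-tabulate-+ {zero}  a b = refl
sum-tabulate-+ {suc m} a b = trans
  (cong (a zero + b zero +_) (sum-tabulate-+ (a ∘ suc) (b ∘ suc)))
  (+-interchange (a zero) (b zero) (sum (tabulate (a ∘ suc))) (sum (tabulate (b ∘ suc))))

sum-tabulate-0 : ∀ m → sum (tabulate {n = m} (const 0)) ≡ 0
sum-tabulate-0 zero    = refl
sum-tabulate-0 (suc m) = sum-tabulate-0 m

sum-tabulate-cong : ∀ {m} {a b : Fin m → ℕ} → (∀ e → a e ≡ b e) → sum (tabulate a) ≡ sum (tabulate b)
sum-tabulate-cong {zero}  eq = refl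
sum-tabulate-cong {suc m} eq = cong₂ _+_ (eq zero) (sum-tabulate-cong (eq ∘ suc))

-- Averaging: if the first index fails, the strict inequality must survive on the remaining ones.
sum-tabulate-<⇒∃ : ∀ {m} c d (a b : Fin m → ℕ) → c * sum (tabulate a) < d * sum (tabulate b) →
                   ∃ λ e → c * a e < d * b e
sum-tabulate-<⇒∃ {zero}  c d a b lt = contradiction (subst₂ _<_ (ℕ.*-zeroʳ c) (ℕ.*-zeroʳ d) lt) λ ()
sum-tabulate-<⇒∃ {suc m} c d a b lt with c * a zero ℕ.<? d * b zero
... | yes lt₀ = zero , lt₀
... | no ≮₀   = let e , ltₑ = sum-tabulate-<⇒∃ c d (a ∘ suc) (b ∘ suc) (ℕ.≰⇒> λ ≤ₛ → ℕ.<⇒≱ lt (subst₂ _≤_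
                      (sym (ℕ.*-distribˡ-+ d (b zero) _)) (sym (ℕ.*-distribˡ-+ c (a zero) _))
                      (ℕ.+-mono-≤ (ℕ.≮⇒≥ ≮₀) ≤ₛ)))
                in suc e , ltₑ

sum-tabulate-indicator : ∀ {m} (p : Subset m) x →
                         sum (tabulate λ e → if does (e ∈? p) then x else 0) ≡ ∣ p ∣ * x
sum-tabulate-indicator []            x = refl
sum-tabulate-indicator (inside ∷ p)  x = cong (x +_) (sum-tabulate-indicator p x)
sum-tabulate-indicator (outside ∷ p) x = sum-tabulate-indicator p x

sum-filter-∷ : ∀ {A : Set} {P : A → Set} (P? : ∀ x → Dec (P x)) (g : A → ℕ) x xs →
               sum (map g (filter P? (x ∷ xs))) ≡
               (if does (P? x) then g x else 0) + sum (map g (filter P? xs))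
sum-filter-∷ P? g x xs with does (P? x)
... | true  = refl
... | false = refl

-- Exchange of summation: an entry `x` passes the filter for exactly `∣ F x ∣` indices.
double-count : ∀ {A : Set} {m} (F : A → Subset m) (g : A → ℕ) xs →
               sum (tabulate λ e → sum (map g (filter (λ x → e ∈? F x) xs))) ≡
               sum (map (λ x → ∣ F x ∣ * g x) xs)
double-count {m = m} F g []       = sum-tabulate-0 m
double-count         F g (x ∷ xs) = trans
  (sum-tabulate-cong λ e → sum-filter-∷ (λ x → e ∈? F x) g x xs)
  (trans (sum-tabulate-+ (λ e → if does (e ∈? F x) then g x else 0) _)
    (cong₂ _+_ (sum-tabulate-indicator (F x) (g x)) (double-count F g xs)))

sum-const-1 : ∀ {A : Set} (xs : List A) → sum (map (const 1) xs) ≡ length xs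
sum-const-1 []       = refl
sum-const-1 (_ ∷ xs) = cong suc (sum-const-1 xs)

sum-map-suc : ∀ xs → sum (map suc xs) ≡ length xs + sum xs
sum-map-suc []       = refl
sum-map-suc (x ∷ xs) = cong suc (trans (cong (x +_) (sum-map-suc xs)) (lemma x (length xs) (sum xs)))
  where
  lemma : ∀ a b c → a + (b + c) ≡ b + (a + c)
  lemma = solve-∀

square : ℕ → ℕ
square x = x * x

sum-map-pronic : ∀ xs → sum (map (λ x → x * suc x) xs) ≡ sum xs + sum (map square xs)
sum-map-pronic []       = refl
sum-map-pronic (x ∷ xs) = trans (cong₂ _+_ (ℕ.*-suc x x) (sum-map-pronic xs))
  (+-interchange x (x * x) (sum xs) (sum (map square xs)))

-- The slack is the square of the difference `d`; splitting on which number is larger avoids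
-- truncated subtraction.
2xy≤x²+y² : ∀ x y → 2 * (x * y) ≤ square x + square y
2xy≤x²+y² x y with ℕ.≤-total x y
... | inj₁ x≤y with d , refl ← ℕ.m≤n⇒∃[o]m+o≡n x≤y =
  ℕ.≤-trans (ℕ.m≤m+n _ (d * d)) (ℕ.≤-reflexive (lemma x d))
  where
  lemma : ∀ x d → 2 * (x * (x + d)) + d * d ≡ x * x + (x + d) * (x + d)
  lemma = solve-∀
... | inj₂ y≤x with d , refl ← ℕ.m≤n⇒∃[o]m+o≡n y≤x =
  ℕ.≤-trans (ℕ.m≤m+n _ (d * d)) (ℕ.≤-reflexive (lemma y d))
  where
  lemma : ∀ y d → 2 * ((y + d) * y) + d * d ≡ (y + d) * (y + d) + y * y
  lemma = solve-∀

-- `2xy≤x²+y²` summed over `ys`. It bounds the cross terms that arise when an entry is added in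
-- `cauchy-schwarz`.
2x*sum≤ : ∀ x ys → 2 * (x * sum ys) ≤ length ys * square x + sum (map square ys)
2x*sum≤ x []       = ℕ.≤-reflexive (cong (2 *_) (ℕ.*-zeroʳ x))
2x*sum≤ x (y ∷ ys) = subst₂ _≤_
  (lemma x y (sum ys))
  (+-interchange (x * x) (y * y) (length ys * (x * x)) _)
  (ℕ.+-mono-≤ (2xy≤x²+y² x y) (2x*sum≤ x ys))
  where
  lemma : ∀ x y s → 2 * (x * y) + 2 * (x * s) ≡ 2 * (x * (y + s))
  lemma = solve-∀

cauchy-schwarz : ∀ xs → square (sum xs) ≤ length xs * sum (map square xs)
cauchy-schwarz []       = z≤n
cauchy-schwarz (x ∷ xs) = subst₂ _≤_ (lemma₁ x (sum xs)) (lemma₂ x (length xs) (sum (map square xs)))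
  (ℕ.+-monoʳ-≤ (x * x) (ℕ.+-mono-≤ (2x*sum≤ x xs) (cauchy-schwarz xs)))
  where
  lemma₁ : ∀ x s → x * x + (2 * (x * s) + s * s) ≡ (x + s) * (x + s)
  lemma₁ = solve-∀
  lemma₂ : ∀ x n q → x * x + ((n * (x * x) + q) + n * q) ≡ (x * x + q) + n * (x * x + q)
  lemma₂ = solve-∀

∈⇒≤sum : ∀ {x xs} → x ∈ˡ xs → x ≤ sum xs
∈⇒≤sum (here refl)         = ℕ.m≤m+n _ _
∈⇒≤sum {xs = y ∷ _} (there x∈) = ℕ.≤-trans (∈⇒≤sum x∈) (ℕ.m≤n+m _ y)

-- Removing a zero entry changes neither sum but shortens the list by one. The inequality for the
-- rest therefore has one sum of squares to spare, which is positive because of the entry `suc x`.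
cauchy-schwarz-strict : ∀ {x xs} → 0 ∈ˡ xs → suc x ∈ˡ xs →
                        square (sum xs) < length xs * sum (map square xs)
cauchy-schwarz-strict {x} {xs} 0∈ x∈ with ys , zs , refl ← ∈-∃++ 0∈ =
  subst₂ _<_
    (cong square (sym (sum-↭ ↭-0∷)))
    (sym (cong₂ _*_ (↭-length ↭-0∷) (sum-↭ (map⁺ square ↭-0∷))))
    (ℕ.+-mono-<-≤ 0<Q (cauchy-schwarz (ys ++ zs)))
  where
  ↭-0∷ : xs ↭ 0 ∷ ys ++ zs
  ↭-0∷ = shift 0 ys zs
  0<Q : 0 < sum (map square (ys ++ zs))
  0<Q = subst (0 <_) (sum-↭ (map⁺ square ↭-0∷)) (ℕ.<-≤-trans (s≤s z≤n) (∈⇒≤sum (∈-map⁺ square x∈)))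

-- The mean of x + 1 weighted by x exceeds its plain mean.
chebyshev-strict : ∀ {x} xs → 0 ∈ˡ xs → suc x ∈ˡ xs →
                   sum (map suc xs) * sum xs < length xs * sum (map (λ x → x * suc x) xs)
chebyshev-strict xs 0∈ x∈ = subst₂ _<_
  (trans (sym (ℕ.*-distribʳ-+ (sum xs) (length xs) (sum xs)))
    (cong (_* sum xs) (sym (sum-map-suc xs))))
  (trans (sym (ℕ.*-distribˡ-+ (length xs) (sum xs) (sum (map square xs))))
    (cong (length xs *_) (sym (sum-map-pronic xs))))
  (ℕ.+-monoʳ-< (length xs * sum xs) (cauchy-schwarz-strict 0∈ x∈))

mean-< : ∀ xs ys → sum xs * length ys < sum ys * length xs → mean xs <ℚ mean ys
-- The hypothesis fails when either list is empty, so the conventional value of `mean` is never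
-- compared.
mean-< xs []         lt = contradiction (subst (_< 0) (ℕ.*-zeroʳ (sum xs)) lt) λ ()
mean-< [] ys@(_ ∷ _) lt = contradiction (subst (0 <_) (ℕ.*-zeroʳ (sum ys)) lt) λ ()
-- Since `/` reduces to lowest terms, the comparison is moved to unnormalised fractions, where it is
-- cross-multiplication.
mean-< xs@(_ ∷ xs′) ys@(_ ∷ ys′) lt = ℚ.toℚᵘ-cancel-<
  (ℚᵘ.<-respˡ-≃ (ℚᵘ.≃-sym (ℚ.toℚᵘ-fromℚᵘ (mkℚᵘ (ℤ.+ sum xs) (length xs′))))
  (ℚᵘ.<-respʳ-≃ (ℚᵘ.≃-sym (ℚ.toℚᵘ-fromℚᵘ (mkℚᵘ (ℤ.+ sum ys) (length ys′))))
  (*<* (subst₂ ℤ._<_ (ℤ.pos-* (sum xs) (length ys)) (ℤ.pos-* (sum ys) (length xs)) (ℤ.+<+ lt)))))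

-- Adding a parallel edge

module _ (G : Multigraph) where

  weight : Subset (order G) × Subset (size G) → ℕ
  weight (W , _) = ∣ W ∣

  edgeCount : Subset (order G) × Subset (size G) → ℕ
  edgeCount (_ , F) = ∣ F ∣

  private
    Subtree = Subset (order G) × Subset (size G)
    L       = subtrees G
    ks      = map edgeCount L

  All-subtrees : ∀ {P : Subtree → Set} → (∀ {T} → IsSubtree G T → P T) → All P L
  All-subtrees p = All.tabulate λ T∈ → p (Equivalence.to (∈-subtrees G) T∈)

  weights : map weight L ≡ map suc ks
  weights = trans (map-cong-local (All-subtrees (∣W∣≡1+∣F∣ G))) (map-∘ L)

  subtrees-through : Edge G → List Subtree
  subtrees-through e = filter (λ T → e ∈? proj₂ T) L

  0∈edgeCounts : Vertex G → 0 ∈ˡ ks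
  0∈edgeCounts v = subst (_∈ˡ ks) (∣⊥∣≡0 (size G))
    (∈-map⁺ edgeCount (Equivalence.from (∈-subtrees G) (isSubtree-vertex G v)))

  1∈edgeCounts : Edge G → 1 ∈ˡ ks
  1∈edgeCounts e = subst (_∈ˡ ks) (∣⁅x⁆∣≡1 e)
    (∈-map⁺ edgeCount (Equivalence.from (∈-subtrees G) (isSubtree-edge G e)))

  -- The products compare two mean orders without division. Summed over all edges, double counting
  -- turns the totals into sums of `k` and of `k * suc k` over the edge counts `k`, to which
  -- `chebyshev-strict` applies.
  ∃-heavy-edge : Edge G → ∃ λ e → sum (map weight L) * length (subtrees-through e) <
                                  length L * sum (map weight (subtrees-through e))
  ∃-heavy-edge e₀ =
    let e , lt = sum-tabulate-<⇒∃ (sum (map weight L)) (length L)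
                   (λ e → sum (map (const 1) (subtrees-through e)))
                   (λ e → sum (map weight (subtrees-through e)))
                   (subst₂ (λ a b → sum (map weight L) * a < length L * b)
                     (sym edgeSum) (sym weightSum) total)
    in e , subst (λ n → sum (map weight L) * n < length L * sum (map weight (subtrees-through e)))
             (sum-const-1 (subtrees-through e)) lt
    where
    edgeSum : sum (tabulate λ e → sum (map (const 1) (subtrees-through e))) ≡ sum ks
    edgeSum = trans (double-count proj₂ (const 1) L)
      (cong sum (map-cong-local (All-subtrees λ {T} _ → ℕ.*-identityʳ (edgeCount T))))
    weightSum : sum (tabulate λ e → sum (map weight (subtrees-through e))) ≡ sum (map (λ x → x * suc x) ks)
    weightSum = trans (double-count proj₂ weight L) (cong sum (trans
      (map-cong-local (All-subtrees λ {T} t → cong (edgeCount T *_) (∣W∣≡1+∣F∣ G t))) (map-∘ L)))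
    total : sum (map weight L) * sum ks < length L * sum (map (λ x → x * suc x) ks)
    total = subst₂ (λ ws n → sum ws * sum ks < n * sum (map (λ x → x * suc x) ks))
      (sym weights) (length-map edgeCount L)
      -- A single vertex supplies the edge count 0 and a single edge the count 1, which gives
      -- strictness.
      (chebyshev-strict ks (0∈edgeCounts (proj₁ (ends G e₀))) (1∈edgeCounts e₀))

-- Subtrees after doubling an edge

module _ (G : Multigraph) (e : Edge G) where

  duplicate : Multigraph
  duplicate = addEdge G (proj₁ (ends G e)) (proj₂ (ends G e)) (loopless G e)

  keep : Subset (order G) × Subset (size G) → Subset (order G) × Subset (size duplicate)
  keep (W , F) = W , outside ∷ F

  -- Exchanges the labels of e and its copy; used on subtrees through e, but injective everywhere.
  exchange : Subset (order G) × Subset (size G) → Subset (order G) × Subset (size duplicate)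
  exchange (W , F) = W , lookup F e ∷ F [ e ]≔ outside

  exchange-injective : ∀ {T T′} → exchange T ≡ exchange T′ → T ≡ T′
  exchange-injective {W , F} {W′ , F′} eq = trans (sym (unexchange-exchange W F))
    (trans (cong unexchange eq) (unexchange-exchange W′ F′))
    where
    unexchange : Subset (order G) × Subset (size duplicate) → Subset (order G) × Subset (size G)
    unexchange (W , b ∷ F) = W , F [ e ]≔ b
    unexchange-exchange : ∀ W F → unexchange (exchange (W , F)) ≡ (W , F)
    unexchange-exchange W F = cong (W ,_) (trans (Vec.[]≔-idempotent F e) (Vec.[]≔-lookup F e))

  keep-embedding : ∀ {F} → Embedding (edgesOf G) (edgesOf duplicate) F (outside ∷ F)
  keep-embedding = record
    { to = suc ; to∈ = there ; ends-to = λ _ → refl ; to-inj = λ _ _ → Fin.suc-injective }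

  -- Merges the two parallel edges, hence is injective only on edge sets that do not contain both.
  original : Edge duplicate → Edge G
  original zero    = e
  original (suc f) = f

  unkeep-embedding : ∀ {F} → Embedding (edgesOf duplicate) (edgesOf G) (outside ∷ F) F
  unkeep-embedding = record
    { to      = original
    ; to∈     = λ { (there f∈) → f∈ }
    ; ends-to = λ { (there _) → refl }
    ; to-inj  = λ { (there _) (there _) refl → refl } }

  -- A section of `original` that avoids `suc e`, and therefore injective; it moves subtrees through
  -- `e` onto the new edge.
  copy : Edge G → Edge duplicate
  copy f with f Fin.≟ e
  ... | yes _ = zero
  ... | no _  = suc f

  original-copy : ∀ f → original (copy f) ≡ f
  original-copy f with f Fin.≟ e
  ... | yes refl = refl
  ... | no _     = refl

  ends-original : ∀ f → ends G (original f) ≡ ends duplicate f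
  ends-original zero    = refl
  ends-original (suc _) = refl

  -- `F` is what remains of a subtree once its parallel edge is taken out: `F⁺` puts back `e`, and
  -- `inside ∷ F` the new edge.
  module _ {F : Subset (size G)} (e∉F : e ∉ F) where

    private
      F⁺ = F [ e ]≔ inside

      ∈⁺ : ∀ {f} → f ∈ F → f ∈ F⁺
      ∈⁺ {f} f∈ = Vec.[]≔-minimal F f e (λ { refl → e∉F f∈ }) f∈

      ∈⁻ : ∀ {f} → f ≢ e → f ∈ F⁺ → f ∈ F
      ∈⁻ {f} f≢e f∈ = Vec.lookup⇒[]= f F (trans (sym (Vec.lookup∘update′ f≢e F inside)) (Vec.[]=⇒lookup f∈))

    copy-embedding : Embedding (edgesOf G) (edgesOf duplicate) F⁺ (inside ∷ F)
    copy-embedding = record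
      { to      = copy
      ; to∈     = copy∈
      ; ends-to = λ {f} _ → trans (sym (ends-original (copy f))) (cong (ends G) (original-copy f))
      ; to-inj  = λ {f} {g} _ _ eq → trans (sym (original-copy f)) (trans (cong original eq) (original-copy g))
      }
      where
      copy∈ : ∀ {f} → f ∈ F⁺ → copy f ∈ inside ∷ F
      copy∈ {f} f∈ with f Fin.≟ e
      ... | yes _   = here
      ... | no f≢e = there (∈⁻ f≢e f∈)

    original-embedding : Embedding (edgesOf duplicate) (edgesOf G) (inside ∷ F) F⁺
    original-embedding = record
      { to      = original
      ; to∈     = λ { here → Vec.[]≔-updates F e ; (there f∈) → ∈⁺ f∈ }
      ; ends-to = λ {f} _ → ends-original f
      ; to-inj  = λ { here       here       _    → refl
                    ; here       (there f∈) refl → contradiction f∈ e∉F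
                    ; (there f∈) here       refl → contradiction f∈ e∉F
                    ; (there _)  (there _)  refl → refl }
      }

  -- The new edge and `e` together form a cycle of length two.
  parallel-exclusive : ∀ {W F} → IsSubtree duplicate (W , inside ∷ F) → e ∉ F
  parallel-exclusive {F = F} t e∈ = IsSubtree.acyclic t
    ( _ , step {v = proj₂ (ends G e)} zero here (inj₁ refl)
          (step (suc e) (there e∈) (inj₂ refl) nil) , (λ ())
    , ((λ ()) ∷ []) ∷ [] ∷ [] , (loopless G e ∷ []) ∷ [] ∷ [])

  -- Exhibits a preimage under `exchange` for each subtree through the new edge.
  exchange-inverse : ∀ {F} → e ∉ F →
                     lookup (F [ e ]≔ inside) e ∷ (F [ e ]≔ inside) [ e ]≔ outside ≡ inside ∷ F
  exchange-inverse {F} e∉F = cong₂ _∷_ (Vec.lookup∘update e F inside)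
    (trans (Vec.[]≔-idempotent F e) (trans (cong (F [ e ]≔_) (sym lookup≡)) (Vec.[]≔-lookup F e)))
    where
    lookup≡ : lookup F e ≡ outside
    lookup≡ with lookup F e in eq
    ... | outside = refl
    ... | inside  = contradiction (Vec.lookup⇒[]= e F eq) e∉F

  isSubtree-exchange : ∀ {W F} → e ∈ F → IsSubtree G (W , F) → IsSubtree duplicate (exchange (W , F))
  isSubtree-exchange {W} {F} e∈F t = subst (λ b → IsSubtree duplicate (W , b ∷ F⁻))
    (sym (Vec.[]=⇒lookup e∈F))
    (isSubtree-transfer (copy-embedding e∉F⁻) (original-embedding e∉F⁻)
      (subst (λ F → IsSubtree G (W , F)) (sym restore) t))
    where
    F⁻ = F [ e ]≔ outside
    e∉F⁻ : e ∉ F⁻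
    e∉F⁻ e∈ = contradiction (trans (sym (Vec.[]=⇒lookup e∈)) (Vec.lookup∘update e F outside)) λ ()
    restore : F⁻ [ e ]≔ inside ≡ F
    restore = trans (Vec.[]≔-idempotent F e)
      (trans (cong (F [ e ]≔_) (sym (Vec.[]=⇒lookup e∈F))) (Vec.[]≔-lookup F e))

  -- A subtree avoiding the new edge is one of `G`; a subtree using it cannot contain `e`, so it is
  -- the exchange of a subtree through `e`. Neither list has repetitions, so having the same members
  -- makes them permutations of each other.
  subtrees-duplicate : subtrees duplicate ↭ map keep (subtrees G) ++ map exchange (subtrees-through G e)
  subtrees-duplicate = ∼bag⇒↭ (unique∧set⇒bag (subtrees-unique duplicate) split! (mk⇔ to from))
    where
    through? : ∀ T → Dec (e ∈ proj₂ T)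
    through? T = e ∈? proj₂ T

    disjoint : ∀ {T} → ¬ (T ∈ˡ map keep (subtrees G) × T ∈ˡ map exchange (subtrees-through G e))
    disjoint (T∈ , T∈′) with ∈-map⁻ keep T∈ | ∈-map∘filter⁻ exchange through? {xs = subtrees G} T∈′
    -- The first bit tells the two families apart, as it records whether the new edge is used.
    ... | _ , _ , refl | _ , _ , eq , e∈ =
      contradiction (trans (cong (λ T → lookup (proj₂ T) zero) eq) (Vec.[]=⇒lookup e∈)) λ ()

    split! : Unique (map keep (subtrees G) ++ map exchange (subtrees-through G e))
    split! = Unique.++⁺
      (Unique.map⁺ (λ { refl → refl }) (subtrees-unique G))
      (Unique.map⁺ exchange-injective (Unique.filter⁺ through? (subtrees-unique G)))
      disjoint

    to : ∀ {T} → T ∈ˡ subtrees duplicate →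
         T ∈ˡ map keep (subtrees G) ++ map exchange (subtrees-through G e)
    to {W , outside ∷ F} T∈ = ∈-++⁺ˡ (∈-map⁺ keep (Equivalence.from (∈-subtrees G)
      (isSubtree-transfer unkeep-embedding keep-embedding (Equivalence.to (∈-subtrees duplicate) T∈))))
    to {W , inside ∷ F}  T∈ = ∈-++⁺ʳ _ (∈-map∘filter⁺ exchange through? {xs = subtrees G}
      ( (W , F [ e ]≔ inside)
      , Equivalence.from (∈-subtrees G) (isSubtree-transfer (original-embedding e∉F) (copy-embedding e∉F) t)
      , cong (W ,_) (sym (exchange-inverse e∉F))
      , Vec.[]≔-updates F e))
      where
      t   = Equivalence.to (∈-subtrees duplicate) T∈
      e∉F = parallel-exclusive t

    from : ∀ {T} → T ∈ˡ map keep (subtrees G) ++ map exchange (subtrees-through G e) →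
           T ∈ˡ subtrees duplicate
    from T∈ with ∈-++⁻ (map keep (subtrees G)) T∈
    ... | inj₁ T∈ˡ with _ , T₀∈ , refl ← ∈-map⁻ keep T∈ˡ =
      Equivalence.from (∈-subtrees duplicate)
      (isSubtree-transfer keep-embedding unkeep-embedding (Equivalence.to (∈-subtrees G) T₀∈))
    ... | inj₂ T∈ʳ with _ , T₀∈ , refl , e∈ ← ∈-map∘filter⁻ exchange through? {xs = subtrees G} T∈ʳ =
      Equivalence.from (∈-subtrees duplicate)
      (isSubtree-exchange e∈ (Equivalence.to (∈-subtrees G) T₀∈))

  weights-duplicate : map (weight duplicate) (subtrees duplicate) ↭
                      map (weight G) (subtrees G) ++ map (weight G) (subtrees-through G e)
  weights-duplicate = subst (map (weight duplicate) (subtrees duplicate) ↭_)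
    (trans (map-++ (weight duplicate) (map keep (subtrees G)) _)
      (cong₂ _++_ (sym (map-∘ (subtrees G))) (sym (map-∘ (subtrees-through G e)))))
    (map⁺ (weight duplicate) subtrees-duplicate)

  -- Appending a family of larger mean raises the mean: after expanding, `sum ws * length ws` occurs
  -- on both sides and the hypothesis remains.
  μ-duplicate : sum (map (weight G) (subtrees G)) * length (subtrees-through G e) <
                length (subtrees G) * sum (map (weight G) (subtrees-through G e)) →
                μ duplicate > μ G
  μ-duplicate lt = mean-< ws (map (weight duplicate) (subtrees duplicate))
    (subst₂ (λ n s → sum ws * n < s * length ws)
      (sym (trans (↭-length weights-duplicate) (length-++ ws)))
      (sym (trans (sum-↭ weights-duplicate) (sum-++ ws wsₑ)))
      (subst₂ _<_ (sym (ℕ.*-distribˡ-+ (sum ws) (length ws) (length wsₑ)))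
                  (sym (ℕ.*-distribʳ-+ (length ws) (sum ws) (sum wsₑ)))
        (ℕ.+-monoʳ-< (sum ws * length ws) lt′)))
    where
    ws  = map (weight G) (subtrees G)
    wsₑ = map (weight G) (subtrees-through G e)
    lt′ : sum ws * length wsₑ < sum wsₑ * length ws
    lt′ = subst₂ (λ m n → sum ws * m < n)
      (sym (length-map (weight G) (subtrees-through G e)))
      (trans (ℕ.*-comm (length (subtrees G)) (sum wsₑ))
        (cong (sum wsₑ *_) (sym (length-map (weight G) (subtrees G)))))
      lt

-- The edgeless case and the conclusion

sum-weights : ∀ G → sum (map (weight G) (subtrees G)) ≡
                    length (map (weight G) (subtrees G)) + sum (map (edgeCount G) (subtrees G))
sum-weights G = trans (cong sum (weights G)) (trans (sum-map-suc ks)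
  (cong (_+ sum ks) (trans (length-map (edgeCount G) L) (sym (length-map (weight G) L)))))
  where
  L  = subtrees G
  ks = map (edgeCount G) L

-- The mean order is one plus the mean edge count. This is exactly 1 for `G`, and more for `H`
-- because a single edge is a subtree.
μ-edgeless : ∀ G H → Vertex G → ¬ Edge G → Edge H → μ H > μ G
μ-edgeless G H v ¬e f = mean-< ws ws′
  (subst₂ (λ a b → a * length ws′ < b * length ws)
    (sym (trans (sum-weights G) (trans (cong (length ws +_) K≡0) (ℕ.+-identityʳ _))))
    (sym (sum-weights H))
    (subst (_< (length ws′ + K′) * length ws) (ℕ.*-comm (length ws′) (length ws))
      (ℕ.*-monoˡ-< (length ws) (ℕ.m<m+n (length ws′) 0<K′))))
  where
  ws  = map (weight G) (subtrees G)
  ws′ = map (weight H) (subtrees H)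
  no-edges : ∀ Ts → sum (map (edgeCount G) Ts) ≡ 0
  no-edges []             = refl
  no-edges ((W , F) ∷ Ts) = cong₂ _+_
    (trans (cong ∣_∣ (Empty-unique {p = F} λ (e , _) → ¬e e)) (∣⊥∣≡0 (size G))) (no-edges Ts)
  K≡0 : sum (map (edgeCount G) (subtrees G)) ≡ 0
  K≡0 = no-edges (subtrees G)
  K′ : ℕ
  K′ = sum (map (edgeCount H) (subtrees H))
  0<K′ : 0 < K′
  0<K′ = ∈⇒≤sum (1∈edgeCounts H f)
  -- Multiplying by `length ws` preserves strictness because the single vertex `v` is a subtree of
  -- `G`.
  instance
    ws≢[] : NonZero (length ws)
    ws≢[] = nonZero (∈-map⁺ (weight G) (Equivalence.from (∈-subtrees G) (isSubtree-vertex G v)))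
      where
      nonZero : ∀ {x xs} → x ∈ˡ xs → NonZero (length xs)
      nonZero {xs = _ ∷ _} _ = _

element? : ∀ n → Dec (Fin n)
element? zero    = no λ ()
element? (suc n) = yes zero

distinctPair : ∀ {n} → 2 ≤ n → Σ[ u ∈ Fin n ] Σ[ v ∈ Fin n ] u ≢ v
distinctPair (s≤s (s≤s z≤n)) = zero , suc zero , λ ()

proposition4p3 : (G : Multigraph) → 2 ≤ order G →
    Σ[ u ∈ Vertex G ] Σ[ v ∈ Vertex G ] Σ[ u≢v ∈ u ≢ v ] μ (addEdge G u v u≢v) > μ G
proposition4p3 G 2≤n with element? (size G)
... | yes e₀ = let e , heavy = ∃-heavy-edge G e₀ in
  proj₁ (ends G e) , proj₂ (ends G e) , loopless G e , μ-duplicate G e heavy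
... | no ¬e = let u , v , u≢v = distinctPair 2≤n in
  u , v , u≢v , μ-edgeless G (addEdge G u v u≢v) u ¬e zero
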